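{- Let $G=(V,E)$ be a graph and let $e=uv\in E$ be an edge. Then $$\gamma_{\rm esp}(G)-1\le \gamma_{\rm esp}(G-e)\le \gamma_{\rm esp}(G)+2.$$
   Context: Graphs are finite, simple and undirected. For a graph $G=(V,E)$ and $S\subseteq V$, write $\overline{S}=V\setminus S$, and let $N(v)$ be the open neighbourhood of $v$. A set $S \subseteq V$ is an end super dominating set (ESD-set) of $G$ if for every $u\in\overline{S}$ there exists $v\in S$ with $N(v)\cap\overline{S}=\{u\}$, and moreover $\deg(u)\ge 2$ for every $u\in\overline{S}$. The end super domination number $\gamma_{\rm esp}(G)$ is the minimum cardinality of an ESD-set of $G$. $G-e$ denotes the graph obtained from $G$ by removing the edge $e$ (keeping all vertices); it need not be connected. -}

module Defs where

open import Data.Bool.Properties using () renaming (_≟_ to _≟ᵇ_)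
open import Data.Fin.Base using (Fin)
open import Data.Fin.Properties using (_≟_; all?; any?)
open import Data.Fin.Subset using (Subset; _∈_; ∁; _∩_; ⁅_⁆; ∣_∣; ⊤)
open import Data.Fin.Subset.Properties using (_∈?_; ∈⊤; x∈∁p⇒x∉p; anySubset?)
open import Data.Nat.Base using (ℕ; _≤_; _<_)
open import Data.Nat.Induction using (<-wellFounded)
open import Data.Nat.Properties using (_≤?_; _<?_; ≮⇒≥)
open import Data.Product.Base using (∃; _×_; _,_; proj₁; proj₂)
open import Data.Sum.Base using (_⊎_; inj₁; inj₂)
open import Data.Vec.Base using (tabulate)
open import Data.Vec.Properties using (≡-dec)
open import Induction.WellFounded using (Acc; acc)
open import Level using (0ℓ)
open import Relation.Binary.Core using (Rel)
open import Relation.Binary.Definitions using (Decidable; Symmetric)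
open import Relation.Binary.PropositionalEquality.Core using (_≡_)
open import Relation.Nullary using (¬_; Dec; yes; no; does; contradiction)
open import Relation.Nullary.Decidable using (_×-dec_; _⊎-dec_; _→-dec_; ¬?)

record Graph (n : ℕ) : Set₁ where
  field
    Adj    : Rel (Fin n) 0ℓ
    adj?   : Decidable Adj
    sym    : Symmetric Adj
    irrefl : ∀ {v} → ¬ Adj v v

  N : Fin n → Subset n
  N v = tabulate (λ w → does (adj? v w))

  deg : Fin n → ℕ
  deg v = ∣ N v ∣

open Graph public using (Adj)

-- Total in u and v: nothing changes unless u and v are adjacent.
deleteEdge : ∀ {n} → Graph n → Fin n → Fin n → Graph n
deleteEdge {n} G u v = record
  { Adj    = λ x y → Adj G x y × ¬ Ends x y
  ; adj?   = λ x y → G.adj? x y ×-dec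
      ¬? (((x ≟ u) ×-dec (y ≟ v)) ⊎-dec ((x ≟ v) ×-dec (y ≟ u)))
  ; sym    = λ (a , ¬e) → G.sym a , λ e → ¬e (swapEnds e)
  ; irrefl = λ (a , _) → G.irrefl a
  }
  where
  module G = Graph G

  Ends : Rel (Fin n) 0ℓ
  Ends x y = (x ≡ u × y ≡ v) ⊎ (x ≡ v × y ≡ u)

  swapEnds : ∀ {x y} → Ends x y → Ends y x
  swapEnds (inj₁ (p , q)) = inj₂ (q , p)
  swapEnds (inj₂ (p , q)) = inj₁ (q , p)

IsESD : ∀ {n} → Graph n → Subset n → Set
IsESD G S = ∀ u → u ∈ ∁ S →
  (∃ λ v → v ∈ S × N v ∩ ∁ S ≡ ⁅ u ⁆) × 2 ≤ deg u
  where open Graph G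

isESD? : ∀ {n} (G : Graph n) (S : Subset n) → Dec (IsESD G S)
isESD? G S = all? λ u → (u ∈? ∁ S) →-dec
  (any? (λ v → (v ∈? S) ×-dec ≡-dec _≟ᵇ_ (N v ∩ ∁ S) ⁅ u ⁆) ×-dec (2 ≤? deg u))
  where open Graph G

⊤-isESD : ∀ {n} (G : Graph n) → IsESD G ⊤
⊤-isESD G u u∈∁⊤ = contradiction ∈⊤ (x∈∁p⇒x∉p u∈∁⊤)

IsMinimumESD : ∀ {n} → Graph n → Subset n → Set
IsMinimumESD G S = IsESD G S × (∀ T → IsESD G T → ∣ S ∣ ≤ ∣ T ∣)

minimumESD : ∀ {n} (G : Graph n) → ∃ (IsMinimumESD G)
minimumESD G = descend ⊤ (⊤-isESD G) (<-wellFounded _)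
  where
  descend : ∀ S → IsESD G S → Acc _<_ ∣ S ∣ → ∃ (IsMinimumESD G)
  descend S esd (acc rs)
    with anySubset? (λ T → isESD? G T ×-dec (∣ T ∣ <? ∣ S ∣))
  ... | yes (T , esd′ , T<S) = descend T esd′ (rs T<S)
  ... | no none = S , esd , λ T esd′ → ≮⇒≥ λ T<S → none (T , esd′ , T<S)

γesp : ∀ {n} → Graph n → ℕ
γesp G = ∣ proj₁ (minimumESD G) ∣

{-# OPTIONS --safe #-}
-- The complement of an ESD-set S of H is still end super dominated in G after S is
-- enlarged to T, with the same witnesses, as long as H and G have the same edges
-- between S and the complement of T and no degree outside T drops.
-- For deleting uv from G take T = S ∪ {u, v}.  For adding uv back, the only harmful
-- case is an edge between S and its complement, and one more vertex in T removes it.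
module Submission where

open import Defs
open import Data.Fin.Base using (Fin; zero; suc)
open import Data.Fin.Subset using (Subset; inside; outside; _∈_; _∉_; _⊆_; ∁; _∩_; _∪_; ⁅_⁆; ∣_∣)
open import Data.Fin.Subset.Properties
open import Data.Nat.Base using (ℕ; suc; _+_; _∸_; _≤_; s≤s)
open import Data.Nat.Properties using (≤-reflexive; ≤-trans; m≤n⇒m≤1+n; +-comm; m≤n+o⇒m∸n≤o; module ≤-Reasoning)
open import Data.Product.Base using (_×_; _,_; proj₁; proj₂)
open import Data.Sum.Base using (inj₁; inj₂)
open import Data.Vec.Base using (_∷_)
open import Data.Vec.Properties using (lookup∘tabulate; []=⇒lookup; lookup⇒[]=)
open import Function.Base using (_∘_)
open import Relation.Binary.PropositionalEquality using (_≡_; refl; sym; trans; cong; subst)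
open import Relation.Nullary using (yes; no)
open import Relation.Nullary.Decidable using (dec-true)

∣p∪⁅x⁆∣≤1+∣p∣ : ∀ {n} (p : Subset n) x → ∣ p ∪ ⁅ x ⁆ ∣ ≤ suc ∣ p ∣
∣p∪⁅x⁆∣≤1+∣p∣ (inside  ∷ p) zero    = s≤s (m≤n⇒m≤1+n (≤-reflexive (cong ∣_∣ (∪-identityʳ p))))
∣p∪⁅x⁆∣≤1+∣p∣ (outside ∷ p) zero    = s≤s (≤-reflexive (cong ∣_∣ (∪-identityʳ p)))
∣p∪⁅x⁆∣≤1+∣p∣ (inside  ∷ p) (suc x) = s≤s (∣p∪⁅x⁆∣≤1+∣p∣ p x)
∣p∪⁅x⁆∣≤1+∣p∣ (outside ∷ p) (suc x) = ∣p∪⁅x⁆∣≤1+∣p∣ p x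

x∈p∪⁅x⁆ : ∀ {n} (p : Subset n) x → x ∈ p ∪ ⁅ x ⁆
x∈p∪⁅x⁆ p x = q⊆p∪q p ⁅ x ⁆ (x∈⁅x⁆ x)

module _ {n} (G : Graph n) where
  open Graph G using (N; adj?)

  ∈N⁺ : ∀ {v w} → Adj G v w → w ∈ N v
  ∈N⁺ {v} {w} a = lookup⇒[]= w (N v) (trans (lookup∘tabulate _ w) (dec-true (adj? v w) a))

  ∈N⁻ : ∀ {v w} → w ∈ N v → Adj G v w
  ∈N⁻ {v} {w} w∈N with adj? v w | trans (sym (lookup∘tabulate _ w)) ([]=⇒lookup w∈N)
  ... | yes a | _ = a
  ... | no _  | ()

γesp-≤ : ∀ {n} (G : Graph n) {T} → IsESD G T → γesp G ≤ ∣ T ∣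
γesp-≤ G = proj₂ (proj₂ (minimumESD G)) _

-- Passing to `T` only shrinks the complement, and the first edge condition gives a witness no new
-- neighbour there. The second keeps its edge to `u` and the bound on the degree of `u`.
IsESD-transfer : ∀ {n} (H G : Graph n) {S T : Subset n} → S ⊆ T →
  (∀ {x w} → x ∈ S → w ∉ T → Adj G x w → Adj H x w) →
  (∀ {w x} → w ∉ T → Adj H w x → Adj G w x) →
  IsESD H S → IsESD G T
IsESD-transfer H G {S} {T} S⊆T G⇒H H⇒G esd u u∈∁T
  with u∉T ← x∈∁p⇒x∉p u∈∁T
  with (x , x∈S , N∩∁S≡u) , 2≤deg ← esd u (x∉p⇒x∈∁p (u∉T ∘ S⊆T))
  = (x , S⊆T x∈S , ⊆-antisym ⊆u u⊆) ,
    ≤-trans 2≤deg (p⊆q⇒∣p∣≤∣q∣ (∈N⁺ G ∘ H⇒G u∉T ∘ ∈N⁻ H))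
  where
  ⊆u : Graph.N G x ∩ ∁ T ⊆ ⁅ u ⁆
  ⊆u w∈ with w∈N , w∈∁T ← x∈p∩q⁻ _ _ w∈ with w∉T ← x∈∁p⇒x∉p w∈∁T =
    subst (_ ∈_) N∩∁S≡u
      (x∈p∩q⁺ (∈N⁺ H (G⇒H x∈S w∉T (∈N⁻ G w∈N)) , x∉p⇒x∈∁p (w∉T ∘ S⊆T)))

  u⊆ : ⁅ u ⁆ ⊆ Graph.N G x ∩ ∁ T
  u⊆ w∈ with refl ← x∈⁅y⁆⇒x≡y u w∈
    -- `H⇒G` moves only edges that start outside `T`, so the edge from `x` to `u` is reversed, moved
    -- and reversed back.
    with u∈N , _ ← x∈p∩q⁻ (Graph.N H x) (∁ S) (subst (u ∈_) (sym N∩∁S≡u) (x∈⁅x⁆ u)) =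
    x∈p∩q⁺ (∈N⁺ G (Graph.sym G (H⇒G u∉T (Graph.sym H (∈N⁻ H u∈N)))) , u∈∁T)

module _ {n} (G : Graph n) (u v : Fin n) where
  private
    G-e = deleteEdge G u v

  γesp-deleteEdge-≤ : γesp G-e ≤ γesp G + 2
  γesp-deleteEdge-≤ with S , esd , _ ← minimumESD G = begin
    γesp G-e               ≤⟨ γesp-≤ G-e T-isESD ⟩
    ∣ T ∣                  ≤⟨ ∣p∪⁅x⁆∣≤1+∣p∣ (S ∪ ⁅ u ⁆) v ⟩
    1 + ∣ S ∪ ⁅ u ⁆ ∣      ≤⟨ s≤s (∣p∪⁅x⁆∣≤1+∣p∣ S u) ⟩
    2 + ∣ S ∣              ≡⟨ +-comm 2 ∣ S ∣ ⟩
    ∣ S ∣ + 2              ∎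
    where
    open ≤-Reasoning
    T = (S ∪ ⁅ u ⁆) ∪ ⁅ v ⁆

    T-isESD : IsESD G-e T
    T-isESD = IsESD-transfer G G-e (p⊆p∪q _ ∘ p⊆p∪q _) (λ _ _ → proj₁)
      -- Both ends of the removed edge lie in `T`; an end left outside could drop from degree 2 to
      -- 1.
      (λ w∉T a → a , λ where
        (inj₁ (refl , _)) → w∉T (p⊆p∪q _ (x∈p∪⁅x⁆ S u))
        (inj₂ (refl , _)) → w∉T (x∈p∪⁅x⁆ _ v))
      esd

  γesp-≤-1+deleteEdge : γesp G ≤ suc (γesp G-e)
  γesp-≤-1+deleteEdge with S , esd , _ ← minimumESD G-e with u ∈? S
  -- Adding `v` puts both ends into `T`, so the restored edge never reaches the complement.
  ... | yes u∈S = ≤-trans (γesp-≤ G T-isESD) (∣p∪⁅x⁆∣≤1+∣p∣ S v)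
    where
    T-isESD : IsESD G (S ∪ ⁅ v ⁆)
    T-isESD = IsESD-transfer G-e G (p⊆p∪q _)
      (λ _ w∉T a → a , λ where
        (inj₁ (_ , refl)) → w∉T (x∈p∪⁅x⁆ S v)
        (inj₂ (_ , refl)) → w∉T (p⊆p∪q _ u∈S))
      (λ _ → proj₁) esd
  -- Here `u` is no old witness, and `v`, if it is one, gains only the neighbour `u`, which now lies
  -- in `T`. So it does not matter whether `v ∈ S`.
  ... | no u∉S = ≤-trans (γesp-≤ G T-isESD) (∣p∪⁅x⁆∣≤1+∣p∣ S u)
    where
    T-isESD : IsESD G (S ∪ ⁅ u ⁆)
    T-isESD = IsESD-transfer G-e G (p⊆p∪q _)
      (λ x∈S w∉T a → a , λ where
        (inj₁ (refl , _)) → u∉S x∈S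
        (inj₂ (_ , refl)) → w∉T (x∈p∪⁅x⁆ S u))
      (λ _ → proj₁) esd

theorem6p1 : ∀ {n : ℕ} (G : Graph n) (u v : Fin n) → Adj G u v →
    (γesp G ∸ 1 ≤ γesp (deleteEdge G u v)) × (γesp (deleteEdge G u v) ≤ γesp G + 2)
-- An ESD-set of a graph with a vertex is nonempty, so `γesp G ∸ 1` is the true difference.
theorem6p1 G u v _ = m≤n+o⇒m∸n≤o _ 1 (γesp-≤-1+deleteEdge G u v) , γesp-deleteEdge-≤ G u v
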